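{- Given any positive integer $k$, $$\overrightarrow{TR}(k) \leq \overrightarrow{R}(2k-1) + (2k-1)\,\overrightarrow{R}(k).$$
   Context: $T_k$ denotes the transitive tournament on $k$ vertices. A perfect $T_k$-packing in an oriented graph $G$ is a collection of vertex-disjoint copies of $T_k$ in $G$ which covers all the vertices of $G$. The oriented tiling Ramsey number $\overrightarrow{TR}(k)$ is the smallest positive integer $n$ divisible by $k$ such that any orientation of the complete graph $K_n$ contains a perfect $T_k$-packing. The oriented Ramsey number $\overrightarrow{R}(k)$ is the smallest positive integer $n$ such that any orientation of $K_n$ contains a copy of $T_k$. It is known that both numbers exist for every $k$. -}

module Defs where

open import Data.Fin.Base as Fin using (Fin)
open import Data.Fin.Properties using (<-asym)
open import Data.Nat.Base using (ℕ; _≤_; _<_)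
open import Data.Nat.Divisibility using (_∣_)
open import Data.Product.Base using (∃-syntax; _×_)
open import Data.Sum.Base using (_⊎_)
open import Function.Definitions using (Injective)
open import Level using (Level; 0ℓ)
open import Relation.Binary.Core using (Rel; _Preserves_⟶_)
open import Relation.Binary.Definitions using (Asymmetric)
open import Relation.Binary.PropositionalEquality.Core using (_≡_; _≢_)

private
  variable
    ℓ : Level
    k n : ℕ

-- Asymmetry excludes loops as well as pairs of opposite edges.
record OrientedGraph (n : ℕ) : Set₁ where
  field
    Edge : Rel (Fin n) 0ℓ
    asym : Asymmetric Edge

open OrientedGraph public

-- Together with `asym`, this also makes `Edge G` decidable, so nothing is lost
-- by working constructively with a Set-valued edge relation.
OrientsComplete : OrientedGraph n → Set
OrientsComplete G = ∀ u v → u ≢ v → Edge G u v ⊎ Edge G v u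

T : (k : ℕ) → OrientedGraph k
T k = record { Edge = Fin._<_ ; asym = <-asym }

record Copy (H : OrientedGraph k) (G : OrientedGraph n) : Set where
  field
    embed     : Fin k → Fin n
    injective : Injective _≡_ _≡_ embed
    preserves : embed Preserves Edge H ⟶ Edge G

open Copy public

Disjoint : {H : OrientedGraph k} {G : OrientedGraph n} → Rel (Copy H G) 0ℓ
Disjoint C D = ∀ a b → embed C a ≢ embed D b

record PerfectPacking (H : OrientedGraph k) (G : OrientedGraph n) : Set where
  field
    size     : ℕ
    copy     : Fin size → Copy H G
    disjoint : ∀ i j → i ≢ j → Disjoint (copy i) (copy j)
    covers   : ∀ v → ∃[ i ] ∃[ a ] embed (copy i) a ≡ v

IsLeast : (ℕ → Set ℓ) → ℕ → Set ℓ
IsLeast P n = P n × (∀ m → P m → n ≤ m)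

-- The two Ramsey numbers are given by their graphs: `IsRamsey k n` says that n is
-- the oriented Ramsey number of k, and `IsTilingRamsey k n` that n is the oriented
-- tiling Ramsey number of k. Each determines n uniquely.
IsRamsey : ℕ → ℕ → Set₁
IsRamsey k = IsLeast λ n →
  0 < n × ((G : OrientedGraph n) → OrientsComplete G → Copy (T k) G)

IsTilingRamsey : ℕ → ℕ → Set₁
IsTilingRamsey k = IsLeast λ n →
  0 < n × k ∣ n × ((G : OrientedGraph n) → OrientsComplete G → PerfectPacking (T k) G)

{-# OPTIONS --safe #-}

-- A tournament T₂ₖ₋₁ together with any further vertex v has a perfect
-- Tₖ-packing: v dominates, or is dominated by, k - 1 of the vertices, which form
-- a Tₖ with v, and the other k vertices form a Tₖ as well. So in a tournament on
-- n > r₁ + (2k-1) r₂ - k vertices, with k ∣ n, reserve r₂ - 1 disjoint copies of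
-- T₂ₖ₋₁, remove copies of Tₖ from the rest until fewer than r₂ vertices are
-- left, and let each of these be absorbed by its own reserved copy. The number of
-- reserved copies left over is then divisible by k; they are used up k at a time,
-- by splitting one of them into a Tₖ and k - 1 vertices absorbed by k - 1 others.
module Submission where

open import Data.Nat using (ℕ; _+_; _*_; _∸_; _≤_; _<_)
open import Defs

open import Data.Empty using (⊥; ⊥-elim)
open import Data.Fin.Base as Fin using (Fin; zero; suc; inject≤)
import Data.Fin.Properties as Fin
open import Data.List.Base
  using (List; []; _∷_; _++_; [_]; length; concat; lookup; tabulate; allFin; take; drop)
open import Data.List.Membership.Propositional using (_∈_)
open import Data.List.Membership.Propositional.Properties
  using (∈-∃++; ∈-lookup; ∈-tabulate⁻; ∈-allFin; ∈-concat⁺′; ∈-concat⁻)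
open import Data.List.Properties
  using
    ( ++-assoc; ++-identityʳ; concat-++; length-++
    ; length-take; length-drop; length-tabulate; take++drop≡id )
open import Data.List.Relation.Binary.Permutation.Propositional
  using (_↭_; ↭-refl; ↭-reflexive; ↭-trans; prep; ↭⇒↭ₛ; module PermutationReasoning)
open import Data.List.Relation.Binary.Permutation.Propositional.Properties
  using (∈-resp-↭; ↭-length; shift; shifts; ++⁺; ++⁺ˡ) renaming (++-comm to ++-comm-↭)
import Data.List.Relation.Binary.Permutation.Setoid.Properties as ↭ₛ
open import Data.List.Relation.Binary.Subset.Propositional using (_⊆_)
open import Data.List.Relation.Ternary.Interleaving.Propositional
  using (Interleaving; []; consˡ; consʳ; swap; toPermutation)
open import Data.List.Relation.Unary.All as All using (All; []; _∷_)
import Data.List.Relation.Unary.All.Properties as All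
open import Data.List.Relation.Unary.AllPairs as AllPairs using (AllPairs; []; _∷_)
import Data.List.Relation.Unary.AllPairs.Properties as AllPairs
open import Data.List.Relation.Unary.Any as Any using (here; there)
import Data.List.Relation.Unary.Any.Properties as Any
open import Data.List.Relation.Unary.Unique.Propositional using (Unique)
open import Data.List.Relation.Unary.Unique.Propositional.Properties using (allFin⁺)
open import Data.Nat.Base using (zero; suc; z≤n; s≤s)
open import Data.Nat.Divisibility
  using (_∣_; divides; ∣m+n∣m⇒∣n; n∣m*n; ∣⇒≤)
open import Data.Nat.DivMod using (_/_; m≡m%n+[m/n]*n; m%n<n; m/n*n≤m)
open import Data.Nat.Induction using (Acc; acc; <-wellFounded)
open import Data.Nat.Properties
open import Data.Product.Base using (∃₂; ∃-syntax; _×_; _,_; proj₁; proj₂)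
open import Data.Sum.Base as Sum using (_⊎_; inj₁; inj₂)
open import Function.Base using (_∘_; _$_; id)
open import Function.Definitions using (Injective)
open import Level using (Level)
open import Relation.Binary.Core using (Rel)
open import Relation.Binary.Definitions using (tri<; tri≈; tri>)
open import Relation.Binary.PropositionalEquality
  using (_≡_; _≢_; refl; sym; trans; cong; cong₂; subst; setoid; module ≡-Reasoning)
open import Relation.Nullary using (yes; no; contradiction)
open import Relation.Unary using (Pred)

private
  variable
    a ℓ : Level
    A : Set a
    k m n r : ℕ

-- Lists without repetition, and blocks of a concatenation.

Unique-resp-↭ : {xs ys : List A} → xs ↭ ys → Unique xs → Unique ys
Unique-resp-↭ σ = ↭ₛ.Unique-resp-↭ (setoid _) (↭⇒↭ₛ σ)

AllPairs-++⁻ʳ : {R : Rel A ℓ} (xs : List A) {ys : List A} → AllPairs R (xs ++ ys) → AllPairs R ys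
AllPairs-++⁻ʳ []       p       = p
AllPairs-++⁻ʳ (x ∷ xs) (_ ∷ p) = AllPairs-++⁻ʳ xs p

AllPairs-lookup : {R : Rel A ℓ} {xs : List A} → AllPairs R xs →
                  ∀ {i j} → i Fin.< j → R (lookup xs i) (lookup xs j)
AllPairs-lookup (px ∷ _)  {zero}  {suc j} _         = All.lookup px (∈-lookup j)
AllPairs-lookup (_ ∷ pxs) {suc i} {suc j} (s≤s i<j) = AllPairs-lookup pxs i<j

-- By trichotomy, two distinct indices are related one way or the other. This serves both for `_≢_`
-- on repetition-free lists and for the edge relation on transitive lists.
<-preserving⇒injective : {R : Rel A ℓ} → (∀ {x y} → R x y → x ≢ y) →
                         (f : Fin n → A) → (∀ {i j} → i Fin.< j → R (f i) (f j)) →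
                         Injective _≡_ _≡_ f
<-preserving⇒injective irrefl f pres {i} {j} eq with Fin.<-cmp i j
... | tri< i<j _ _ = contradiction eq (irrefl (pres i<j))
... | tri≈ _ i≡j _ = i≡j
... | tri> _ _ j<i = contradiction (sym eq) (irrefl (pres j<i))

Unique-lookup-injective : {xs : List A} → Unique xs → Injective _≡_ _≡_ (lookup xs)
Unique-lookup-injective {xs = xs} uniq =
  <-preserving⇒injective id (lookup xs) (AllPairs-lookup uniq)

Unique-++-disjoint : (xs : List A) {ys : List A} {x : A} →
                     Unique (xs ++ ys) → x ∈ xs → x ∈ ys → ⊥
Unique-++-disjoint (x ∷ xs) (q ∷ _) (here refl) x∈ys = All.lookup (All.++⁻ʳ xs q) x∈ys refl
Unique-++-disjoint (_ ∷ xs) (_ ∷ p) (there x∈)  x∈ys = Unique-++-disjoint xs p x∈ x∈ys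

-- This is the list form of the disjointness of the copies in a packing.
Unique-concat-block : (xss : List (List A)) → Unique (concat xss) → ∀ i j {x} →
                      x ∈ lookup xss i → x ∈ lookup xss j → i ≡ j
Unique-concat-block (xs ∷ xss) u zero    zero    _ _ = refl
Unique-concat-block (xs ∷ xss) u zero    (suc j) p q =
  ⊥-elim (Unique-++-disjoint xs u p (∈-concat⁺′ q (∈-lookup {xs = xss} j)))
Unique-concat-block (xs ∷ xss) u (suc i) zero    p q =
  ⊥-elim (Unique-++-disjoint xs u q (∈-concat⁺′ p (∈-lookup {xs = xss} i)))
Unique-concat-block (xs ∷ xss) u (suc i) (suc j) p q =
  cong suc (Unique-concat-block xss (AllPairs-++⁻ʳ xs u) i j p q)

-- The elements of `ys` are pulled out of `xs` one at a time. As `ys` has no repetition, removing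
-- one of them leaves all later ones in place.
Unique-⊆⇒↭-++ : {ys : List A} (xs : List A) → Unique ys → ys ⊆ xs → ∃[ zs ] xs ↭ ys ++ zs
Unique-⊆⇒↭-++ {ys = []}     xs _         _   = xs , ↭-refl
Unique-⊆⇒↭-++ {ys = y ∷ ys} xs (y∉ ∷ uys) ys⊆xs
  with as , bs , refl ← ∈-∃++ (ys⊆xs (here refl)) =
  let zs , σ = Unique-⊆⇒↭-++ (as ++ bs) uys ys⊆′
  in zs , ↭-trans (shift y as bs) (prep y σ)
  where
  ys⊆′ : ys ⊆ as ++ bs
  ys⊆′ z∈ys with ∈-resp-↭ (shift y as bs) (ys⊆xs (there z∈ys))
  ... | here refl = contradiction refl (All.lookup y∉ z∈ys)
  ... | there z∈  = z∈

-- Order-preserving selections and the pigeonhole principle.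

All-interleaving : {P : Pred A ℓ} {ls rs xs : List A} → Interleaving ls rs xs → All P xs → All P rs
All-interleaving []        []         = []
All-interleaving (consˡ σ) (_ ∷ pxs)  = All-interleaving σ pxs
All-interleaving (consʳ σ) (px ∷ pxs) = px ∷ All-interleaving σ pxs

AllPairs-interleaving : {R : Rel A ℓ} {ls rs xs : List A} →
                        Interleaving ls rs xs → AllPairs R xs → AllPairs R rs
AllPairs-interleaving []        []         = []
AllPairs-interleaving (consˡ σ) (_ ∷ pxs)  = AllPairs-interleaving σ pxs
AllPairs-interleaving (consʳ σ) (px ∷ pxs) = All-interleaving σ px ∷ AllPairs-interleaving σ pxs

-- An interleaving keeps the order within both `ls` and `rs`, so if `xs` is transitive, then so are
-- both parts.
Selection : Pred A ℓ → ℕ → List A → Set _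
Selection P m xs = ∃₂ λ ls rs → Interleaving ls rs xs × All P ls × length ls ≡ m

empty-selection : {P : Pred A ℓ} (xs : List A) → Selection P 0 xs
empty-selection xs = [] , xs , interleaving xs , [] , refl
  where
  interleaving : ∀ xs → Interleaving [] xs xs
  interleaving []       = []
  interleaving (x ∷ xs) = consʳ (interleaving xs)

select : {P : Pred A ℓ} {x : A} {xs : List A} → P x →
         Selection P m xs → Selection P (suc m) (x ∷ xs)
select px (ls , rs , σ , pls , eq) = _ ∷ ls , rs , consˡ σ , px ∷ pls , cong suc eq

skip : {P : Pred A ℓ} {x : A} {xs : List A} → Selection P m xs → Selection P m (x ∷ xs)
skip (ls , rs , σ , pls , eq) = ls , _ ∷ rs , consʳ σ , pls , eq

-- The head of the list lowers the quota of a property that it has, and the first quota to reach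
-- zero gives the selection. Falling short of both quotas would leave at most `p + q - 2` elements.
pigeonhole : {P Q : Pred A ℓ} (p q : ℕ) (xs : List A) → All (λ x → P x ⊎ Q x) xs →
             p + q ≤ suc (length xs) → Selection P p xs ⊎ Selection Q q xs
pigeonhole zero    q       xs _ _ = inj₁ (empty-selection xs)
pigeonhole (suc p) zero    xs _ _ = inj₂ (empty-selection xs)
-- Two positive quotas add up to at least 2, while the empty list allows at most 1.
pigeonhole (suc p) (suc q) [] [] (s≤s le) with () ← subst (_≤ 0) (+-suc p q) le
pigeonhole (suc p) (suc q) (x ∷ xs) (inj₁ px ∷ pqs) (s≤s le) =
  Sum.map (select px) skip (pigeonhole p (suc q) xs pqs le)
pigeonhole (suc p) (suc q) (x ∷ xs) (inj₂ qx ∷ pqs) (s≤s le) =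
  Sum.map skip (select qx)
    (pigeonhole (suc p) q xs pqs (subst (_≤ suc (length xs)) (+-suc p q) le))

length-concat-uniform : {P : Pred (List A) ℓ} → (∀ {xs} → P xs → length xs ≡ m) →
                  {xss : List (List A)} → All P xss → length (concat xss) ≡ length xss * m
length-concat-uniform len []                       = refl
length-concat-uniform len (_∷_ {x = xs} pxs pxss) =
  trans (length-++ xs) (cong₂ _+_ (len pxs) (length-concat-uniform len pxss))

-- Transitive lists of vertices, and packings as lists of blocks.

induced : OrientedGraph n → (Fin r → Fin n) → OrientedGraph r
induced G f = record { Edge = λ i j → Edge G (f i) (f j) ; asym = asym G }

ForcesTransitive : ℕ → ℕ → Set₁
ForcesTransitive k r = (G : OrientedGraph r) → OrientsComplete G → Copy (T k) G

module _ (G : OrientedGraph n) where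

  -- A list stands for the transitive tournament on its elements, in this order.
  Transitive : ℕ → List (Fin n) → Set
  Transitive k xs = length xs ≡ k × AllPairs (Edge G) xs

  Edge⇒≢ : ∀ {u v} → Edge G u v → u ≢ v
  Edge⇒≢ e refl = asym G e e

  Transitive⇒Copy : {xs : List (Fin n)} → Transitive k xs → Copy (T k) G
  Transitive⇒Copy {xs = xs} (refl , pxs) = record
    { embed     = lookup xs
    ; injective = <-preserving⇒injective Edge⇒≢ (lookup xs) (AllPairs-lookup pxs)
    ; preserves = AllPairs-lookup pxs
    }

  embed-∈ : {xs : List (Fin n)} (t : Transitive k xs) → ∀ i → embed (Transitive⇒Copy t) i ∈ xs
  embed-∈ (refl , _) i = ∈-lookup i

  embed-surjective : {xs : List (Fin n)} (t : Transitive k xs) → ∀ {v} → v ∈ xs →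
                     ∃[ i ] embed (Transitive⇒Copy t) i ≡ v
  embed-surjective (refl , _) v∈xs = Any.index v∈xs , sym (Any.lookup-index v∈xs)

  -- The permutation lets vertices be regrouped freely, while each block keeps the internal order
  -- that witnesses its transitivity.
  Packable : ℕ → List (Fin n) → Set
  Packable k xs = ∃[ yss ] All (Transitive k) yss × xs ↭ concat yss

  Packable-resp-↭ : {xs ys : List (Fin n)} → ys ↭ xs → Packable k xs → Packable k ys
  Packable-resp-↭ σ (yss , tyss , τ) = yss , tyss , ↭-trans σ τ

  Packable-++ : {xs ys : List (Fin n)} → Packable k xs → Packable k ys → Packable k (xs ++ ys)
  Packable-++ (yss , tyss , σ) (zss , tzss , τ) =
    yss ++ zss , All.++⁺ tyss tzss , ↭-trans (++⁺ σ τ) (↭-reflexive (concat-++ yss zss))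

  Transitive⇒Packable : {xs : List (Fin n)} → Transitive k xs → Packable k xs
  Transitive⇒Packable {xs = xs} t =
    [ xs ] , t ∷ [] , ↭-reflexive (sym (++-identityʳ xs))

  Packable-length : {xs : List (Fin n)} → Packable k xs → k ∣ length xs
  Packable-length (yss , tyss , σ) =
    divides (length yss) (trans (↭-length σ) (length-concat-uniform proj₁ tyss))

  Packable⇒PerfectPacking : Packable k (allFin n) → PerfectPacking (T k) G
  Packable⇒PerfectPacking {k} (yss , tyss , σ) = record
    { size     = length yss
    ; copy     = λ i → Transitive⇒Copy (t i)
    ; disjoint = λ i j i≢j a b eq → i≢j $ Unique-concat-block yss (Unique-resp-↭ σ (allFin⁺ n)) i j
                   (embed-∈ (t i) a) (subst (_∈ lookup yss j) (sym eq) (embed-∈ (t j) b))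
    ; covers   = λ v → let v∈ = ∈-concat⁻ yss (∈-resp-↭ σ (∈-allFin v))
                       in Any.index v∈ , embed-surjective (t _) (Any.lookup-index v∈)
    }
    where
    t : ∀ i → Transitive k (lookup yss i)
    t i = All.lookup tyss (∈-lookup i)

  -- Extraction of transitive subtournaments.

  module _ (orients : OrientsComplete G) where

    -- The Ramsey property is applied to the tournament induced on the first `r` entries of `xs`.
    find-transitive : ForcesTransitive k r → (xs : List (Fin n)) → Unique xs → r ≤ length xs →
                      ∃₂ λ ys zs → Transitive k ys × xs ↭ ys ++ zs
    find-transitive forces xs uniq r≤ =
      let zs , σ = Unique-⊆⇒↭-++ xs (AllPairs.map Edge⇒≢ pys) ys⊆xs
      in ys , zs , (length-tabulate _ , pys) , σ
      where
      f : Fin _ → Fin n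
      f i = lookup xs (inject≤ i r≤)
      f-injective : Injective _≡_ _≡_ f
      f-injective eq = Fin.inject≤-injective r≤ r≤ _ _ (Unique-lookup-injective uniq eq)
      C : Copy (T _) (induced G f)
      C = forces (induced G f) (λ u v u≢v → orients (f u) (f v) (u≢v ∘ f-injective))
      ys : List (Fin n)
      ys = tabulate (f ∘ embed C)
      pys : AllPairs (Edge G) ys
      pys = AllPairs.tabulate⁺-< (preserves C)
      ys⊆xs : ys ⊆ xs
      ys⊆xs y∈ with i , refl ← ∈-tabulate⁻ y∈ = ∈-lookup (inject≤ (embed C i) r≤)

    -- Each extraction uses up `m` vertices, so at least `r` of them remain throughout.
    reserve : ForcesTransitive m r → ∀ c (xs : List (Fin n)) → Unique xs → r + c * m ≤ length xs →
              ∃₂ λ tss zs → All (Transitive m) tss × length tss ≡ c × xs ↭ concat tss ++ zs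
    reserve forces zero xs uniq le = [] , xs , [] , refl , ↭-refl
    reserve {m} {r} forces (suc c) xs uniq le
      with ts , ys , t , σ ← find-transitive forces xs uniq (≤-trans (m≤m+n r _) le)
      with tss , zs , ptss , len , τ ← reserve forces c ys
             (AllPairs-++⁻ʳ ts (Unique-resp-↭ σ uniq))
             (let open ≤-Reasoning in +-cancelˡ-≤ m _ _ (begin
               m + (r + c * m)        ≡⟨ +-comm m _ ⟩
               r + c * m + m          ≡⟨ +-assoc r _ m ⟩
               r + (c * m + m)        ≡⟨ cong (r +_) (+-comm (c * m) m) ⟩
               r + (m + c * m)        ≤⟨ le ⟩
               length xs              ≡⟨ ↭-length σ ⟩
               length (ts ++ ys)      ≡⟨ length-++ ts ⟩
               length ts + length ys  ≡⟨ cong (_+ length ys) (proj₁ t) ⟩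
               m + length ys          ∎)) =
      ts ∷ tss , zs , t ∷ ptss , cong suc len ,
      ↭-trans σ (↭-trans (++⁺ˡ ts τ) (↭-reflexive (sym (++-assoc ts (concat tss) zs))))

    -- The recursion is on the number of vertices left, which drops at each extraction because `k`
    -- is positive.
    pack-greedily : 0 < k → ForcesTransitive k r → (xs : List (Fin n)) → Unique xs →
                    Acc _<_ (length xs) →
                    ∃₂ λ ys zs → Packable k ys × length zs < r × xs ↭ ys ++ zs
    pack-greedily {k} {r} 0<k forces xs uniq (acc rec) with r ≤? length xs
    ... | no r≰ = [] , xs , ([] , [] , ↭-refl) , ≰⇒> r≰ , ↭-refl
    ... | yes r≤
      with ts , us , t , σ ← find-transitive forces xs uniq r≤
      with ys , zs , p , lt , τ ← pack-greedily 0<k forces us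
             (AllPairs-++⁻ʳ ts (Unique-resp-↭ σ uniq))
             (let open ≤-Reasoning in rec (begin-strict
               length us              <⟨ m<n+m (length us) 0<k ⟩
               k + length us          ≡⟨ cong (_+ length us) (proj₁ t) ⟨
               length ts + length us  ≡⟨ length-++ ts ⟨
               length (ts ++ us)      ≡⟨ ↭-length σ ⟨
               length xs              ∎)) =
      ts ++ ys , zs , Packable-++ (Transitive⇒Packable t) p , lt ,
      ↭-trans σ (↭-trans (++⁺ˡ ts τ) (↭-reflexive (sym (++-assoc ts ys zs))))

    -- Absorption of vertices by reserved tournaments.

    absorb : suc m ≡ suc k + suc k → ∀ {ts v} → Transitive m ts → All (v ≢_) ts →
             Packable (suc k) (v ∷ ts)
    absorb {m} {k} m+1≡ {ts} {v} (len , pts) v∉ts =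
      Sum.[ dominating , dominated ]′
        (pigeonhole k k ts (All.map (orients v _) v∉ts)
          -- The blocks have order `suc k`, so `v` needs `k` partners, and `k + k` is at most
          -- `2k + 2`, which is `suc (length ts)`.
          (≤-trans (+-mono-≤ (n≤1+n k) (n≤1+n k)) (≤-reflexive (sym (trans (cong suc len) m+1≡)))))
      where
      rest-length : ∀ {ls rs} → Interleaving ls rs ts → length ls ≡ k → length rs ≡ suc k
      rest-length {ls} {rs} σ eq = +-cancelˡ-≡ k _ _ (suc-injective (begin
        suc k + length rs               ≡⟨ cong (λ l → suc l + length rs) eq ⟨
        suc (length ls + length rs)     ≡⟨ cong suc (length-++ ls) ⟨
        suc (length (ls ++ rs))         ≡⟨ cong suc (↭-length (toPermutation σ)) ⟨
        suc (length ts)                 ≡⟨ cong suc len ⟩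
        suc m                           ≡⟨ m+1≡ ⟩
        suc k + suc k                   ∎))
        where open ≡-Reasoning

      rest : ∀ {ls rs} → Interleaving ls rs ts → length ls ≡ k → Packable (suc k) rs
      rest σ eq = Transitive⇒Packable (rest-length σ eq , AllPairs-interleaving σ pts)

      dominating : Selection (Edge G v) k ts → Packable (suc k) (v ∷ ts)
      dominating (ls , rs , σ , v→ls , eq) =
        Packable-resp-↭ (prep v (toPermutation σ)) $ Packable-++
          -- Here `v` comes first, as it dominates `ls`. `swap` makes `ls` the right-hand part,
          -- whose order `AllPairs-interleaving` keeps.
          (Transitive⇒Packable (cong suc eq , v→ls ∷ AllPairs-interleaving (swap σ) pts))
          (rest σ eq)

      dominated : Selection (λ u → Edge G u v) k ts → Packable (suc k) (v ∷ ts)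
      dominated (ls , rs , σ , ls→v , eq) =
        -- Here `v` has to follow the vertices that dominate it, so it moves to the end of `ls`.
        Packable-resp-↭ (begin
          v ∷ ts              ↭⟨ prep v (toPermutation σ) ⟩
          v ∷ ls ++ rs        ↭⟨ shift v ls rs ⟨
          ls ++ [ v ] ++ rs   ≡⟨ ++-assoc ls [ v ] rs ⟨
          (ls ++ [ v ]) ++ rs ∎) $
        Packable-++
          (Transitive⇒Packable
            ( trans (length-++ ls) (trans (+-comm _ 1) (cong suc eq))
            , AllPairs.++⁺ (AllPairs-interleaving (swap σ) pts) ([] ∷ []) (All.map (_∷ []) ls→v)))
          (rest σ eq)
        where open PermutationReasoning

    -- Induction on the reserved copies. The first copy absorbs the next vertex of `bs`; once `bs`
    -- is empty, the copy is split into a block and `k` vertices that form the new `bs`. Each step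
    -- removes a packable list, so the divisibility of the total length persists.
    absorb-all : suc m ≡ suc k + suc k → ∀ tss bs → All (Transitive m) tss →
                 length bs ≤ length tss → Unique (concat tss ++ bs) →
                 suc k ∣ length (concat tss ++ bs) → Packable (suc k) (concat tss ++ bs)
    absorb-all m+1≡ [] [] _ _ _ _ = [] , [] , ↭-refl
    absorb-all {m} {k} m+1≡ (ts ∷ tss) (b ∷ bs) (t ∷ ptss) (s≤s le) uniq div =
      Packable-resp-↭ σ $ Packable-++ p $ absorb-all m+1≡ tss bs ptss le
        (AllPairs-++⁻ʳ (b ∷ ts) uniq′)
        (∣m+n∣m⇒∣n
          (subst (suc k ∣_) (trans (↭-length σ) (length-++ (b ∷ ts))) div)
          (Packable-length p))
      where
      open PermutationReasoning
      σ : concat (ts ∷ tss) ++ b ∷ bs ↭ (b ∷ ts) ++ concat tss ++ bs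
      σ = begin
        (ts ++ concat tss) ++ b ∷ bs   ↭⟨ shift b (ts ++ concat tss) bs ⟩
        b ∷ (ts ++ concat tss) ++ bs   ≡⟨ cong (b ∷_) (++-assoc ts (concat tss) bs) ⟩
        b ∷ ts ++ concat tss ++ bs     ∎
      uniq′ : Unique ((b ∷ ts) ++ concat tss ++ bs)
      uniq′ = Unique-resp-↭ σ uniq
      p : Packable (suc k) (b ∷ ts)
      p = absorb m+1≡ t (All.++⁻ˡ ts (AllPairs.head uniq′))
    absorb-all {m} {k} m+1≡ (ts ∷ tss) [] (t ∷ ptss) _ uniq div =
      Packable-resp-↭ σ $ Packable-++ p $ absorb-all m+1≡ tss bs ptss
        -- The number of copies, `ts` included, is a positive multiple of `suc k`. So at least `k`
        -- copies remain besides `ts`, enough for the `k` new vertices.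
        (≤-trans (≤-reflexive bs-length) (≤-pred (∣⇒≤ k+1∣length)))
        (AllPairs-++⁻ʳ ds (Unique-resp-↭ σ uniq))
        (∣m+n∣m⇒∣n
          (subst (suc k ∣_) (trans (↭-length σ) (length-++ ds)) div)
          (Packable-length p))
      where
      ds = take (suc k) ts
      bs = drop (suc k) ts

      m≡ : m ≡ suc k + k
      m≡ = suc-injective (trans m+1≡ (+-suc (suc k) k))

      p : Packable (suc k) ds
      p = Transitive⇒Packable
        ( trans (length-take (suc k) ts)
                (m≤n⇒m⊓n≡m (≤-trans (m≤m+n (suc k) k) (≤-reflexive (sym (trans (proj₁ t) m≡)))))
        , AllPairs.take⁺ (suc k) (proj₂ t))

      bs-length : length bs ≡ k
      bs-length = trans (length-drop (suc k) ts)
        (trans (cong (_∸ suc k) (trans (proj₁ t) m≡)) (m+n∸m≡n (suc k) k))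

      σ : concat (ts ∷ tss) ++ [] ↭ ds ++ concat tss ++ bs
      σ = begin
        (ts ++ concat tss) ++ []        ≡⟨ ++-identityʳ _ ⟩
        ts ++ concat tss                ≡⟨ cong (_++ concat tss) (take++drop≡id (suc k) ts) ⟨
        (ds ++ bs) ++ concat tss        ≡⟨ ++-assoc ds bs _ ⟩
        ds ++ bs ++ concat tss          ↭⟨ ++⁺ˡ ds (++-comm-↭ bs (concat tss)) ⟩
        ds ++ concat tss ++ bs          ∎
        where open PermutationReasoning

      -- m ≡ -1 modulo k + 1, so k + 1 divides a number s as soon as it divides s * m.
      k+1∣length : suc k ∣ suc (length tss)
      k+1∣length = ∣m+n∣m⇒∣n
        (divides (s + s) (begin
          s * m + s                ≡⟨ +-comm (s * m) s ⟩
          s + s * m                ≡⟨ *-suc s m ⟨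
          s * suc m                ≡⟨ cong (s *_) m+1≡ ⟩
          s * (suc k + suc k)      ≡⟨ *-distribˡ-+ s (suc k) (suc k) ⟩
          s * suc k + s * suc k    ≡⟨ *-distribʳ-+ (suc k) s s ⟨
          (s + s) * suc k          ∎))
        (subst (suc k ∣_)
          (trans (cong length (++-identityʳ (concat (ts ∷ tss))))
                 (length-concat-uniform proj₁ (t ∷ ptss)))
          div)
        where
        open ≡-Reasoning
        s = suc (length tss)

    -- Packing a tournament on sufficiently many vertices.

    tournament-packable : ∀ {r₁ r₂} → suc m ≡ suc k + suc k → ForcesTransitive m r₁ →
      ForcesTransitive (suc k) (suc r₂) → r₁ + r₂ * m ≤ n → suc k ∣ n → Packable (suc k) (allFin n)
    tournament-packable {r₂ = r₂} m+1≡ forces₁ forces₂ le div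
      with tss , us , ptss , len , σ ← reserve forces₁ r₂ (allFin n) (allFin⁺ n)
             (≤-trans le (≤-reflexive (sym (length-tabulate id))))
      with ys , bs , p , lt , τ ← pack-greedily (s≤s z≤n) forces₂ us
             (AllPairs-++⁻ʳ (concat tss) (Unique-resp-↭ σ (allFin⁺ n))) (<-wellFounded _) =
      -- The packed list `ys` moves to the front, so that the reserved copies and the leftover
      -- vertices form one tail for `absorb-all`.
      let ρ = ↭-trans σ (↭-trans (++⁺ˡ (concat tss) τ) (shifts (concat tss) ys)) in
      Packable-resp-↭ ρ $ Packable-++ p $ absorb-all m+1≡ tss bs ptss
        -- Fewer than `suc r₂` vertices are left over, hence at most one for each of the `r₂`
        -- reserved copies.
        (≤-trans (≤-pred lt) (≤-reflexive (sym len)))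
        (AllPairs-++⁻ʳ ys (Unique-resp-↭ ρ (allFin⁺ n)))
        (∣m+n∣m⇒∣n
          (subst (_ ∣_) (trans (sym (length-tabulate id)) (trans (↭-length ρ) (length-++ ys))) div)
          (Packable-length p))

-- Rounding the bound down to a multiple of the block order.

m<n+⌊m/n⌋*n : ∀ m n → m < suc n + m / suc n * suc n
m<n+⌊m/n⌋*n m n =
  ≤-trans (s≤s (≤-reflexive (m≡m%n+[m/n]*n m (suc n)))) (+-monoˡ-≤ _ (m%n<n m (suc n)))

proposition10 : (k : ℕ) → 0 < k →
    (tr r₁ r₂ : ℕ) →
    IsTilingRamsey k tr → IsRamsey (2 * k ∸ 1) r₁ → IsRamsey k r₂ →
    tr ≤ r₁ + (2 * k ∸ 1) * r₂
proposition10 (suc k) _ tr r₁ (suc r₂) (_ , least) ((0<r₁ , forces₁) , _) ((s≤s _ , forces₂) , _) =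
  ≤-trans
    (least N
      ( ≤-trans 0<r₁ (≤-trans (m≤m+n r₁ _) N-large)
      , n∣m*n (M / suc k)
      , λ G orients → Packable⇒PerfectPacking G
          (tournament-packable G orients q+1≡ forces₁ forces₂ N-large (n∣m*n (M / suc k)))))
    (m/n*n≤m M (suc k))
  where
  q = 2 * suc k ∸ 1
  M = r₁ + q * suc r₂
  -- The largest multiple of `suc k` that is at most `M`; minimality of `tr` then gives
  -- `tr ≤ N ≤ M`.
  N = M / suc k * suc k

  q+1≡ : suc q ≡ suc k + suc k
  q+1≡ = cong (suc k +_) (+-identityʳ (suc k))

  -- Rounding `M` down loses at most `k`, while `M` exceeds `r₁ + r₂ * q` by `q`, which is at least
  -- `k`.
  N-large : r₁ + r₂ * q ≤ N
  N-large = +-cancelˡ-≤ (suc k) _ _ (begin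
    suc k + (r₁ + r₂ * q)    ≤⟨ +-monoˡ-≤ (r₁ + r₂ * q) k+1≤q+1 ⟩
    suc q + (r₁ + r₂ * q)    ≡⟨ cong suc (+-comm q _) ⟩
    suc (r₁ + r₂ * q + q)    ≡⟨ cong suc (+-assoc r₁ _ q) ⟩
    suc (r₁ + (r₂ * q + q))  ≡⟨ cong (λ s → suc (r₁ + s)) (trans (+-comm _ q) (*-comm (suc r₂) q)) ⟩
    suc M                    ≤⟨ m<n+⌊m/n⌋*n M k ⟩
    suc k + N                ∎)
    where
    open ≤-Reasoning
    k+1≤q+1 : suc k ≤ suc q
    k+1≤q+1 = ≤-trans (m≤m+n (suc k) (suc k)) (≤-reflexive (sym q+1≡))
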